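{- There is a unique function $h$ such that $h\neq\underline{\mathfrak{0}}$ and $h(x)=\underline{\mathfrak{0}}$ for every $x\neq h$. (This function is denoted $\varphi_0$; one has $\varphi_0=\underline{\mathfrak{0}}\circ\underline{\mathfrak{0}}$.)
   Context: Flow is a first-order theory with equality whose only non-logical symbol is a binary function symbol written $f(x)$; all objects are called functions. Axioms: (F1) $\forall f\forall g\big(((f(g)=f\wedge g(f)=g)\vee(f(g)=g\wedge g(f)=f))\Rightarrow f=g\big)$; (F2) $\forall f\,(f(f)=f)$; (F3) there is a (necessarily unique) $\underline{\mathfrak{1}}$ with $\underline{\mathfrak{1}}(x)=x$ for all $x$; (F4) there is a (necessarily unique) $\underline{\mathfrak{0}}$ with $\underline{\mathfrak{0}}(x)=\underline{\mathfrak{0}}$ for all $x$. Definition ($\mathfrak{F}$-composition): given $f,g$, a function $h$ is the composition $f\circ g$ iff (i) $h\neq\underline{\mathfrak{0}}$; (ii) for all $x$ with $x\neq f$, $x\neq g$, $x\neq h$: $h(x)=f(g(x))$; (iii) if $h\neq f$ then $h(f)=\underline{\mathfrak{0}}$; (iv) if $h\neq g$ then $h(g)=\underline{\mathfrak{0}}$; (v) if $g\neq h$, $f\neq h$, $g\neq\underline{\mathfrak{1}}$ and $f\neq\underline{\mathfrak{1}}$, then $f(g(h))=\underline{\mathfrak{0}}$ or $g(h)=\underline{\mathfrak{0}}$. Axiom (F5, $\mathfrak{F}$-Composition): for all $f,g$ there is exactly one $h$ with $h=f\circ g$. -}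

module Defs where

open import Level using (Level; suc)
open import Data.Product using (_×_; _,_; ∃; ∃!; proj₁; proj₂)
open import Data.Sum using (_⊎_; inj₁; inj₂)
open import Relation.Binary.PropositionalEquality using (_≡_; _≢_)

-- f · x is the paper's f(x).  `IsComposition _·_ 𝟙 𝟘 f g h` is the defining
-- condition of "h is the 𝔉-composition of f and g".
record IsComposition {ℓ : Level} {A : Set ℓ} (_·_ : A → A → A) (𝟙 𝟘 : A)
                     (f g h : A) : Set ℓ where
  field
    nonzero  : h ≢ 𝟘
    generic  : ∀ x → x ≢ f → x ≢ g → x ≢ h → h · x ≡ f · (g · x)
    at-left  : h ≢ f → h · f ≡ 𝟘
    at-right : h ≢ g → h · g ≡ 𝟘
    at-self  : g ≢ h → f ≢ h → g ≢ 𝟙 → f ≢ 𝟙 →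
               (f · (g · h) ≡ 𝟘) ⊎ (g · h ≡ 𝟘)

-- Models of Flow.  Application is the only primitive operation: 𝟙 and 𝟘 are
-- the witnesses of the existential axioms F3 and F4, which 𝟙-unique and
-- 𝟘-unique show to be the only possible ones.
record Flow (ℓ : Level) : Set (suc ℓ) where
  infixl 7 _·_
  field
    Carrier : Set ℓ
    _·_     : Carrier → Carrier → Carrier
    F1 : ∀ f g → ((f · g ≡ f × g · f ≡ g) ⊎ (f · g ≡ g × g · f ≡ f)) → f ≡ g
    F2 : ∀ f → f · f ≡ f
    F3 : ∃ λ i → ∀ x → i · x ≡ x
    F4 : ∃ λ o → ∀ x → o · x ≡ o

  𝟙 : Carrier
  𝟙 = proj₁ F3

  𝟘 : Carrier
  𝟘 = proj₁ F4

  field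
    F5 : ∀ f g → ∃! _≡_ (IsComposition _·_ 𝟙 𝟘 f g)

  infixr 9 _∘_
  _∘_ : Carrier → Carrier → Carrier
  f ∘ g = proj₁ (F5 f g)

  𝟙-unique : ∀ {i} → (∀ x → i · x ≡ x) → 𝟙 ≡ i
  𝟙-unique {i} p = F1 𝟙 i (inj₂ (proj₂ F3 i , p 𝟙))

  𝟘-unique : ∀ {o} → (∀ x → o · x ≡ o) → 𝟘 ≡ o
  𝟘-unique {o} p = F1 𝟘 o (inj₁ (proj₂ F4 o , p 𝟘))

  Isφ₀ : Carrier → Set ℓ
  Isφ₀ h = h ≢ 𝟘 × (∀ x → x ≢ h → h · x ≡ 𝟘)

{-# OPTIONS --safe #-}
module Submission where

open import Level using (Level)
open import Axiom.ExcludedMiddle using (ExcludedMiddle)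
open import Data.Product using (_×_; _,_; ∃!; proj₁; proj₂)
open import Data.Sum using (inj₂)
open import Function using (_∘′_)
open import Relation.Nullary using (yes; no)
open import Relation.Binary.PropositionalEquality using (_≡_; refl; sym; trans)
open import Defs

-- Since 𝟘 is constantly 𝟘, the conditions defining h = 𝟘 ∘ 𝟘 say exactly that
-- h ≢ 𝟘 and that h vanishes away from itself, so F5 gives existence and
-- uniqueness at once.
module _ {ℓ : Level} (M : Flow ℓ) where
  open Flow M

  Isφ₀⇒IsComposition : ∀ {h} → Isφ₀ h → IsComposition _·_ 𝟙 𝟘 𝟘 𝟘 h
  Isφ₀⇒IsComposition {h} (h≢𝟘 , vanish) = record
    { nonzero  = h≢𝟘
    ; generic  = λ x _ _ x≢h → trans (vanish x x≢h) (sym (proj₂ F4 (𝟘 · x)))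
    ; at-left  = λ h≢𝟘 → vanish 𝟘 (h≢𝟘 ∘′ sym)
    ; at-right = λ h≢𝟘 → vanish 𝟘 (h≢𝟘 ∘′ sym)
    -- Both factors are `𝟘`, so the second alternative reads `𝟘 · h ≡ 𝟘`, an instance of `F4`.
    ; at-self  = λ _ _ _ _ → inj₂ (proj₂ F4 h)
    }

  -- The clause `generic` is silent at the argument `𝟘`, which is both factors; there `at-left`
  -- takes over, since `h ≢ 𝟘`. Excluded middle decides which of the two clauses governs a given
  -- `x`.
  IsComposition⇒Isφ₀ : ExcludedMiddle ℓ →
    ∀ {h} → IsComposition _·_ 𝟙 𝟘 𝟘 𝟘 h → Isφ₀ h
  IsComposition⇒Isφ₀ em {h} c = nonzero , vanish
    where
    open IsComposition c
    vanish : ∀ x → _ → h · x ≡ 𝟘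
    vanish x x≢h with em {x ≡ 𝟘}
    ... | yes refl = at-left nonzero
    ... | no  x≢𝟘  = trans (generic x x≢𝟘 x≢𝟘 x≢h) (proj₂ F4 (𝟘 · x))

theorem6 : ∀ {ℓ : Level} → ExcludedMiddle ℓ → (M : Flow ℓ) →
    let open Flow M in
    ∃! _≡_ Isφ₀ × (∀ φ₀ → Isφ₀ φ₀ → φ₀ ≡ 𝟘 ∘ 𝟘)
theorem6 em M =
  (𝟘 ∘ 𝟘 , IsComposition⇒Isφ₀ M em (proj₁ (proj₂ (F5 𝟘 𝟘))) , unique) ,
  (λ _ p → sym (unique p))
  where
  open Flow M
  unique : ∀ {h} → Isφ₀ h → 𝟘 ∘ 𝟘 ≡ h
  unique p = proj₂ (proj₂ (F5 𝟘 𝟘)) (Isφ₀⇒IsComposition M p)
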